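{- Let $\alpha=(\alpha_i)_{i\geqslant 0}$ and $\beta=(\beta_i)_{i\geqslant 0}$ be two sequences starting with a common first term. Then the following hold. (1) If $\alpha_i=2^{i+1}-1$ and $\beta_i=2(1-2^{i-1})$ for all $i\geqslant 0$, then $\det P_{\alpha,\beta}(n)=\mathcal{J}_{n+2}$ for all $n\geqslant 0$. (2) If $\alpha_i=2^{i+2}-1$ and $\beta_i=2(2^{i-1}+1)$ for all $i\geqslant 0$, then $\det P_{\alpha,\beta}(n)=\mathcal{J}_{n+3}$ for all $n\geqslant 0$.
   Context: For sequences $\alpha,\beta$ with $\alpha_0=\beta_0$, the generalized Pascal triangle $P_{\alpha,\beta}(n)=[P_{i,j}]_{0\leqslant i,j\leqslant n}$ is the square matrix of order $n+1$ with $P_{i,0}=\alpha_i$, $P_{0,i}=\beta_i$ for $0\leqslant i\leqslant n$, and $P_{i,j}=P_{i,j-1}+P_{i-1,j}$ for $1\leqslant i,j\leqslant n$. $\mathcal{J}_n$ is the $n$th Jacobsthal number: $\mathcal{J}_0=0$, $\mathcal{J}_1=1$, $\mathcal{J}_n=\mathcal{J}_{n-1}+2\mathcal{J}_{n-2}$ for $n\geqslant 2$. -}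

module Defs where

open import Algebra.Bundles using (CommutativeRing)
import Algebra.Properties.Semiring.Exp as Exp
import Algebra.Properties.Semiring.Sum as Sum
open import Data.Fin.Base using (Fin; zero; suc; toℕ; punchIn)
open import Data.Integer.Base as ℤ using (ℤ; +_; -[1+_])
open import Data.Nat.Base as ℕ using (ℕ; zero; suc)
open import Data.Rational.Base as ℚ using (ℚ; 1/_; _/_)
open import Data.Rational.Properties using (+-*-commutativeRing)

module Determinant {c ℓ} (R : CommutativeRing c ℓ) where

  open CommutativeRing R using (Carrier; semiring; _*_; -_; 1#)
  open Exp semiring using (_^_)
  open Sum semiring using (sum)

  SquareMatrix : ℕ → Set c
  SquareMatrix n = Fin n → Fin n → Carrier

  minor : ∀ {n} → SquareMatrix (suc n) → Fin (suc n) → SquareMatrix n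
  minor M j i k = M (suc i) (punchIn j k)

  -- Cofactor expansion along the first row; the empty determinant is 1.
  det : ∀ {n} → SquareMatrix n → Carrier
  det {zero}  M = 1#
  det {suc n} M = sum λ j → (- 1#) ^ toℕ j * (M zero j * det (minor M j))

open Determinant +-*-commutativeRing public

open Exp (CommutativeRing.semiring +-*-commutativeRing)
  using () renaming (_^_ to _^ⁿ_)

infixr 8 _^_
_^_ : (p : ℚ) → .{{_ : ℚ.NonZero p}} → ℤ → ℚ
p ^ (+ n)    = p ^ⁿ n
p ^ -[1+ n ] = (1/ p) ^ⁿ suc n

2ℚ : ℚ
2ℚ = + 2 / 1

fromℕ : ℕ → ℚ
fromℕ n = + n / 1

-- The corner is read from α; the first row is β only when α 0 ≡ β 0.
pascal : (α β : ℕ → ℚ) → ℕ → ℕ → ℚ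
pascal α β i       zero    = α i
pascal α β zero    (suc j) = β (suc j)
pascal α β (suc i) (suc j) = pascal α β (suc i) j ℚ.+ pascal α β i (suc j)

P : (α β : ℕ → ℚ) (n : ℕ) → SquareMatrix (suc n)
P α β n i j = pascal α β (toℕ i) (toℕ j)

jacobsthal : ℕ → ℕ
jacobsthal 0             = 0
jacobsthal 1             = 1
jacobsthal (suc (suc n)) = jacobsthal (suc n) ℕ.+ 2 ℕ.* jacobsthal n

module Submission where

-- Column operations suffice. Binomially transforming rows and columns of a Toeplitz
-- matrix T gives a Pascal triangle, so after undoing the column transform by repeated
-- differences of neighbouring columns, P becomes L T with L the unitriangular matrix of
-- binomial coefficients. In both parts T has diagonal d, d - 2 above it and d + 1 below
-- it, with d = 1 or d = 3. Neighbouring columns of T differ in two entries only, so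
-- eliminating to lower triangular form is again a sweep through neighbouring columns, in
-- which each column is rescaled by a Jacobsthal number and ends up with the next Jacobsthal
-- number on the diagonal; the product telescopes.

open import Algebra.Bundles using (CommutativeRing)
import Algebra.Properties.Ring as RingProperties
import Algebra.Properties.Semiring.Exp as Exp
import Algebra.Properties.Semiring.Sum as Sum
import Algebra.Solver.Ring.NaturalCoefficients.Default as SemiringSolver
open import Data.Empty using (⊥-elim)
open import Data.Fin.Base using (Fin; zero; suc; toℕ; fromℕ<; punchIn; punchOut)
open import Data.Fin.Properties as Fin
  using (punchIn-injective; punchInᵢ≢i; punchIn-punchOut; toℕ<n; toℕ-fromℕ<)
open import Data.Integer.Base as ℤ using (+_)
import Data.Integer.Properties as ℤ
open import Data.Nat.Base as ℕ using (ℕ; zero; suc)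
import Data.Nat.Properties as ℕ
open import Data.Product.Base as Product using (_×_; _,_)
open import Data.Rational.Base as ℚ using (ℚ; 0ℚ; 1ℚ; Positive)
open import Data.Rational.Properties as ℚ using (+-*-commutativeRing)
open import Data.Rational.Solver using (module +-*-Solver)
import Data.Rational.Unnormalised.Base as ℚᵘ
import Data.Rational.Unnormalised.Properties as ℚᵘ
open import Data.Vec.Functional using (Vector; updateAt; removeAt)
open import Data.Vec.Functional.Properties using (updateAt-updates; updateAt-minimal)
open import Defs using (module Determinant)
open import Function.Base using (const; _∘_)
open import Relation.Binary.PropositionalEquality as ≡ using (_≡_; _≢_; module ≡-Reasoning)
open import Relation.Nullary using (yes; no)

-- Neighbouring positions under deletion of a column.

-- Lets the induction in `det-adjacent` pass to minors: deleting a third column leaves two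
-- neighbours adjacent.
punchOut-suc : ∀ {n} {j k l : Fin (suc n)} (j≢k : j ≢ k) (j≢l : j ≢ l) →
               toℕ l ≡ suc (toℕ k) → toℕ (punchOut j≢l) ≡ suc (toℕ (punchOut j≢k))
punchOut-suc {j = zero}  {zero}          j≢k _ _  = ⊥-elim (j≢k ≡.refl)
punchOut-suc {j = zero}  {suc k} {suc l} _   _ eq = ℕ.suc-injective eq
punchOut-suc {suc n}     {suc zero}    {zero} {suc zero} _ j≢l _ = ⊥-elim (j≢l ≡.refl)
punchOut-suc {suc (suc n)} {suc (suc j)} {zero} {suc zero} _ _   _ = ≡.refl
punchOut-suc {suc n}     {suc j} {suc k} {suc l} j≢k j≢l eq =
  ≡.cong suc (punchOut-suc (j≢k ∘ ≡.cong suc) (j≢l ∘ ≡.cong suc) (ℕ.suc-injective eq))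

-- Deleting `k` or `l` leaves two lists of columns that disagree in one position only, so the two
-- minors coincide once columns `k` and `l` are equal.
punchIn-adjacent : ∀ {n} {k l : Fin (suc n)} → toℕ l ≡ suc (toℕ k) → (j : Fin n) →
                   punchIn k j ≢ punchIn l j → punchIn k j ≡ l × punchIn l j ≡ k
punchIn-adjacent {k = zero} {suc zero} eq zero _ = ≡.refl , ≡.refl
punchIn-adjacent {k = zero} {suc zero} eq (suc j) ≢ = ⊥-elim (≢ ≡.refl)
punchIn-adjacent {k = suc k} {suc l} eq zero ≢ = ⊥-elim (≢ ≡.refl)
punchIn-adjacent {k = suc k} {suc l} eq (suc j) ≢ =
  Product.map (≡.cong suc) (≡.cong suc) (punchIn-adjacent (ℕ.suc-injective eq) j (≢ ∘ ≡.cong suc))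

-- Determinants over a commutative ring: linearity and column operations.

module DeterminantProperties {c ℓ} (R : CommutativeRing c ℓ) where

  open CommutativeRing R hiding (zero)
  open RingProperties ring using (-1*x≈-x)
  open Determinant R
  open Exp semiring using (_^_)
  open Sum semiring
    using (sum; sum-cong-≋; sum-replicate-zero; sum-remove; ∑-distrib-+; *-distribˡ-sum)
  open SemiringSolver commutativeSemiring using (solve; _:+_; _:*_; _:=_)
  open import Relation.Binary.Reasoning.Setoid setoid

  sum-zero : ∀ {n} {f : Vector Carrier n} → (∀ i → f i ≈ 0#) → sum f ≈ 0#
  sum-zero {n} f≈0 = trans (sum-cong-≋ f≈0) (sum-replicate-zero n)

  sum-pair : ∀ {n} {k l : Fin n} → k ≢ l → {f : Vector Carrier n} →
             (∀ j → j ≢ k → j ≢ l → f j ≈ 0#) → sum f ≈ f k + f l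
  sum-pair {suc zero}    {zero} {zero} k≢l = ⊥-elim (k≢l ≡.refl)
  sum-pair {suc (suc n)} {k}    {l}    k≢l {f} f≈0 = begin
    sum f                                 ≈⟨ sum-remove {i = k} f ⟩
    f k + sum (removeAt f k)              ≈⟨ +-congˡ (sum-remove {i = l′} (removeAt f k)) ⟩
    f k + (f (punchIn k l′) + sum (removeAt (removeAt f k) l′))
      ≈⟨ +-congˡ (+-cong (reflexive (≡.cong f (punchIn-punchOut k≢l)))
                         (sum-zero λ j → f≈0 _ (punchInᵢ≢i k _) (≢l j))) ⟩
    f k + (f l + 0#)                      ≈⟨ +-congˡ (+-identityʳ (f l)) ⟩
    f k + f l                             ∎
    where
    l′ : Fin (suc n)
    l′ = punchOut k≢l

    ≢l : ∀ j → punchIn k (punchIn l′ j) ≢ l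
    ≢l j eq = punchInᵢ≢i l′ j
      (punchIn-injective k _ l′ (≡.trans eq (≡.sym (punchIn-punchOut k≢l))))

  det-cong : ∀ {n} {A B : SquareMatrix n} → (∀ i j → A i j ≈ B i j) → det A ≈ det B
  det-cong {zero}  A≈B = refl
  det-cong {suc n} A≈B = sum-cong-≋ λ j →
    *-congˡ {(- 1#) ^ toℕ j} (*-cong (A≈B zero j) (det-cong λ i k → A≈B (suc i) (punchIn j k)))

  -- Induction on the order. Term `k` of the expansion is linear through its first-row entry, its
  -- minor being common to all three matrices; every other term is linear through its minor.
  det-linear : ∀ {n} (k : Fin n) {A B C : SquareMatrix n} s x →
               (∀ i → A i k ≈ s * B i k + x * C i k) →
               (∀ i j → j ≢ k → A i j ≈ B i j) →
               (∀ i j → j ≢ k → A i j ≈ C i j) →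
               det A ≈ s * det B + x * det C
  det-linear {suc n} k {A} {B} {C} s x Aₖ A≈B A≈C = begin
    sum (term A)                                          ≈⟨ sum-cong-≋ termwise ⟩
    sum (λ j → s * term B j + x * term C j)
      ≈⟨ ∑-distrib-+ (λ j → s * term B j) (λ j → x * term C j) ⟩
    sum (λ j → s * term B j) + sum (λ j → x * term C j)
      ≈⟨ +-cong (*-distribˡ-sum s (term B)) (*-distribˡ-sum x (term C)) ⟨
    s * sum (term B) + x * sum (term C)                   ∎
    where
    term : SquareMatrix (suc n) → Fin (suc n) → Carrier
    term M j = (- 1#) ^ toℕ j * (M zero j * det (minor M j))

    termwise : ∀ j → term A j ≈ s * term B j + x * term C j
    termwise j with j Fin.≟ k
    ... | yes ≡.refl = begin
      term A k
        ≈⟨ *-congˡ (*-congʳ (Aₖ zero)) ⟩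
      g * ((s * B zero k + x * C zero k) * m)
        ≈⟨ solve 6 (λ g s b x c m → g :* ((s :* b :+ x :* c) :* m) :=
                     s :* (g :* (b :* m)) :+ x :* (g :* (c :* m)))
                   refl g s (B zero k) x (C zero k) m ⟩
      s * (g * (B zero k * m)) + x * (g * (C zero k * m))
        ≈⟨ +-cong (*-congˡ (*-congˡ (*-congˡ (det-cong λ i l → A≈B (suc i) _ (punchInᵢ≢i k l)))))
                  (*-congˡ (*-congˡ (*-congˡ (det-cong λ i l → A≈C (suc i) _ (punchInᵢ≢i k l))))) ⟩
      s * term B k + x * term C k ∎
      where
      g = (- 1#) ^ toℕ k
      m = det (minor A k)
    ... | no j≢k = begin
      g * (A zero j * det (minor A j))
        ≈⟨ *-congˡ (*-congˡ (det-linear (punchOut j≢k) s x minorₖ minor≈B minor≈C)) ⟩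
      g * (A zero j * (s * p + x * q))
        ≈⟨ solve 6 (λ g a s p x q → g :* (a :* (s :* p :+ x :* q)) :=
                     s :* (g :* (a :* p)) :+ x :* (g :* (a :* q)))
                   refl g (A zero j) s p x q ⟩
      s * (g * (A zero j * p)) + x * (g * (A zero j * q))
        ≈⟨ +-cong (*-congˡ (*-congˡ (*-congʳ (A≈B zero j j≢k))))
                  (*-congˡ (*-congˡ (*-congʳ (A≈C zero j j≢k)))) ⟩
      s * term B j + x * term C j ∎
      where
      g = (- 1#) ^ toℕ j
      p = det (minor B j)
      q = det (minor C j)

      off : ∀ l → l ≢ punchOut j≢k → punchIn j l ≢ k
      off l l≢k eq = l≢k (punchIn-injective j l (punchOut j≢k)
                            (≡.trans eq (≡.sym (punchIn-punchOut j≢k))))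

      minorₖ : ∀ i → minor A j i (punchOut j≢k) ≈
                     s * minor B j i (punchOut j≢k) + x * minor C j i (punchOut j≢k)
      minorₖ i rewrite punchIn-punchOut j≢k = Aₖ (suc i)

      minor≈B : ∀ i l → l ≢ punchOut j≢k → minor A j i l ≈ minor B j i l
      minor≈B i l l≢k = A≈B (suc i) _ (off l l≢k)

      minor≈C : ∀ i l → l ≢ punchOut j≢k → minor A j i l ≈ minor C j i l
      minor≈C i l l≢k = A≈C (suc i) _ (off l l≢k)

  -- Away from `k` and `l` the minors vanish by induction. The two remaining terms have equal
  -- entries and minors and, by adjacency, opposite signs.
  det-adjacent : ∀ {n} (k l : Fin n) → toℕ l ≡ suc (toℕ k) → {A : SquareMatrix n} →
                 (∀ i → A i k ≈ A i l) → det A ≈ 0#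
  det-adjacent {suc n} k l l≡1+k {A} Aₖ≈Aₗ = begin
    sum term           ≈⟨ sum-pair k≢l term≈0 ⟩
    term k + term l    ≈⟨ +-congˡ termₗ ⟩
    term k + - term k  ≈⟨ -‿inverseʳ (term k) ⟩
    0#                 ∎
    where
    term : Fin (suc n) → Carrier
    term j = (- 1#) ^ toℕ j * (A zero j * det (minor A j))

    k≢l : k ≢ l
    k≢l ≡.refl = ℕ.1+n≢n (≡.sym l≡1+k)

    term≈0 : ∀ j → j ≢ k → j ≢ l → term j ≈ 0#
    term≈0 j j≢k j≢l = begin
      (- 1#) ^ toℕ j * (A zero j * det (minor A j))
        ≈⟨ *-congˡ (*-congˡ (det-adjacent (punchOut j≢k) (punchOut j≢l)
                                          (punchOut-suc j≢k j≢l l≡1+k) {minor A j} columns)) ⟩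
      (- 1#) ^ toℕ j * (A zero j * 0#)  ≈⟨ *-congˡ (zeroʳ _) ⟩
      (- 1#) ^ toℕ j * 0#               ≈⟨ zeroʳ _ ⟩
      0#                                ∎
      where
      columns : ∀ i → minor A j i (punchOut j≢k) ≈ minor A j i (punchOut j≢l)
      columns i rewrite punchIn-punchOut j≢k | punchIn-punchOut j≢l = Aₖ≈Aₗ (suc i)

    minors : ∀ i j → minor A l i j ≈ minor A k i j
    minors i j with punchIn k j Fin.≟ punchIn l j
    ... | yes eq = reflexive (≡.cong (A (suc i)) (≡.sym eq))
    ... | no neq with punchIn-adjacent l≡1+k j neq
    ...   | k↦l , l↦k rewrite k↦l | l↦k = Aₖ≈Aₗ (suc i)

    termₗ : term l ≈ - term k
    termₗ = begin
      (- 1#) ^ toℕ l * (A zero l * det (minor A l))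
        ≈⟨ *-cong (reflexive (≡.cong ((- 1#) ^_) l≡1+k))
                  (*-cong (sym (Aₖ≈Aₗ zero)) (det-cong minors)) ⟩
      (- 1# * (- 1#) ^ toℕ k) * (A zero k * det (minor A k))  ≈⟨ *-assoc _ _ _ ⟩
      - 1# * term k                                           ≈⟨ -1*x≈-x (term k) ⟩
      - term k                                                ∎

  det-addColumn : ∀ {n} (k l : Fin n) → toℕ l ≡ suc (toℕ k) → {A B : SquareMatrix n} → ∀ s x →
                  (∀ i → A i l ≈ s * B i l + x * B i k) →
                  (∀ i j → j ≢ l → A i j ≈ B i j) →
                  det A ≈ s * det B
  det-addColumn k l l≡1+k {A} {B} s x Aₗ A≈B = begin
    det A                  ≈⟨ det-linear l s x Aₗ′ A≈B A≈C ⟩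
    s * det B + x * det C  ≈⟨ +-congˡ (trans (*-congˡ det-C) (zeroʳ x)) ⟩
    s * det B + 0#         ≈⟨ +-identityʳ _ ⟩
    s * det B              ∎
    where
    C : SquareMatrix _
    C i = updateAt (B i) l (const (B i k))

    k≢l : k ≢ l
    k≢l ≡.refl = ℕ.1+n≢n (≡.sym l≡1+k)

    Aₗ′ : ∀ i → A i l ≈ s * B i l + x * C i l
    Aₗ′ i = trans (Aₗ i) (+-congˡ (*-congˡ (reflexive (≡.sym (updateAt-updates l (B i))))))

    A≈C : ∀ i j → j ≢ l → A i j ≈ C i j
    A≈C i j j≢l = trans (A≈B i j j≢l) (reflexive (≡.sym (updateAt-minimal j l (B i) j≢l)))

    det-C : det C ≈ 0#
    det-C = det-adjacent k l l≡1+k λ i → reflexive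
      (≡.trans (updateAt-minimal k l (B i) k≢l) (≡.sym (updateAt-updates l (B i))))

  -- Leading sections of infinite matrices.

  section : (ℕ → ℕ → Carrier) → ∀ n → SquareMatrix n
  section A n i j = A (toℕ i) (toℕ j)

  ∏ : ℕ → (ℕ → Carrier) → Carrier
  ∏ zero    f = 1#
  ∏ (suc n) f = f n * ∏ n f

  ∏-cong : ∀ {f g} → (∀ i → f i ≈ g i) → ∀ n → ∏ n f ≈ ∏ n g
  ∏-cong f≈g zero    = refl
  ∏-cong f≈g (suc n) = *-cong (f≈g n) (∏-cong f≈g n)

  ∏-shift : ∀ n f → f 0 * ∏ n (f ∘ suc) ≈ ∏ (suc n) f
  ∏-shift zero    f = refl
  ∏-shift (suc n) f = begin
    f 0 * (f (suc n) * ∏ n (f ∘ suc))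
      ≈⟨ solve 3 (λ a b c → a :* (b :* c) := b :* (a :* c)) refl _ _ _ ⟩
    f (suc n) * (f 0 * ∏ n (f ∘ suc))  ≈⟨ *-congˡ (∏-shift n f) ⟩
    f (suc n) * ∏ (suc n) f            ∎

  det-lowerTriangular : ∀ A → (∀ {i j} → i ℕ.< j → A i j ≈ 0#) →
                        ∀ n → det (section A n) ≈ ∏ n (λ i → A i i)
  det-lowerTriangular A A≈0 zero    = refl
  det-lowerTriangular A A≈0 (suc n) = begin
    1# * (A 0 0 * det (section A′ n)) + sum term
      ≈⟨ +-cong (*-identityˡ _) (sum-zero term≈0) ⟩
    A 0 0 * det (section A′ n) + 0#  ≈⟨ +-identityʳ _ ⟩
    A 0 0 * det (section A′ n)       ≈⟨ *-congˡ (det-lowerTriangular A′ (A≈0 ∘ ℕ.s≤s) n) ⟩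
    A 0 0 * ∏ n (λ i → A′ i i)       ≈⟨ ∏-shift n (λ i → A i i) ⟩
    ∏ (suc n) (λ i → A i i)          ∎
    where
    A′ : ℕ → ℕ → Carrier
    A′ i j = A (suc i) (suc j)

    term : Fin n → Carrier
    term j = (- 1#) ^ suc (toℕ j) * (A 0 (suc (toℕ j)) * det (minor (section A (suc n)) (suc j)))

    term≈0 : ∀ j → term j ≈ 0#
    term≈0 j = trans (*-congˡ (trans (*-congʳ (A≈0 (ℕ.s≤s ℕ.z≤n))) (zeroˡ _))) (zeroʳ _)

  -- Columns are replaced from left to right, so column `suc j` receives a multiple of its neighbour
  -- in `V`, already replaced, and not of the one in `A`. Only the scalings `s` affect the
  -- determinant.
  det-sweep : (A V : ℕ → ℕ → Carrier) (s x : ℕ → Carrier) →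
              (∀ i → V i 0 ≈ s 0 * A i 0) →
              (∀ i j → V i (suc j) ≈ s (suc j) * A i (suc j) + x j * V i j) →
              ∀ n → det (section V n) ≈ ∏ n s * det (section A n)
  det-sweep A V s x V₀ V₊ n =
    trans (det-cong {n} λ i j → sym (H-below (toℕ i) (toℕ<n j))) (go n ℕ.≤-refl)
    where
    -- The columns below m are already those of V.
    H : ℕ → ℕ → ℕ → Carrier
    H m i j with j ℕ.<? m
    ... | yes _ = V i j
    ... | no _  = A i j

    H-below : ∀ {m} i {j} → j ℕ.< m → H m i j ≈ V i j
    H-below {m} i {j} j<m with j ℕ.<? m
    ... | yes _  = refl
    ... | no j≮m = ⊥-elim (j≮m j<m)

    H-above : ∀ {m} i {j} → m ℕ.≤ j → H m i j ≈ A i j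
    H-above {m} i {j} m≤j with j ℕ.<? m
    ... | yes j<m = ⊥-elim (ℕ.<⇒≱ j<m m≤j)
    ... | no _    = refl

    H-off : ∀ {m} i {j} → j ≢ m → H (suc m) i j ≈ H m i j
    H-off {m} i {j} j≢m with j ℕ.<? m
    ... | yes j<m = H-below i (ℕ.m<n⇒m<1+n j<m)
    ... | no j≮m  = H-above i (ℕ.≤∧≢⇒< (ℕ.≮⇒≥ j≮m) (j≢m ∘ ≡.sym))

    off : ∀ {m} (l : Fin n) → toℕ l ≡ m →
          ∀ i j → j ≢ l → section (H (suc m)) n i j ≈ section (H m) n i j
    off l l≡m i j j≢l = H-off (toℕ i) λ j≡m → j≢l (Fin.toℕ-injective (≡.trans j≡m (≡.sym l≡m)))

    step : ∀ m → m ℕ.< n → det (section (H (suc m)) n) ≈ s m * det (section (H m) n)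
    -- Column 0 has no left neighbour and is merely scaled: linearity with second coefficient 0.
    step zero 0<n = begin
      det (section (H 1) n)
        ≈⟨ det-linear l (s 0) 0# (λ i → column (toℕ i) l≡0) (off l l≡0) (off l l≡0) ⟩
      s 0 * det (section (H 0) n) + 0# * det (section (H 0) n)
        ≈⟨ trans (+-congˡ (zeroˡ _)) (+-identityʳ _) ⟩
      s 0 * det (section (H 0) n) ∎
      where
      l = fromℕ< 0<n
      l≡0 = toℕ-fromℕ< 0<n

      column : ∀ i {q} → q ≡ 0 → H 1 i q ≈ s 0 * H 0 i q + 0# * H 0 i q
      column i ≡.refl = trans (V₀ i) (sym (trans (+-congˡ (zeroˡ _)) (+-identityʳ _)))
    step (suc m) 1+m<n =
      det-addColumn k l (≡.trans l≡1+m (≡.cong suc (≡.sym k≡m))) (s (suc m)) (x m)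
                    (λ i → column (toℕ i) k≡m l≡1+m) (off l l≡1+m)
      where
      k = fromℕ< (ℕ.<-trans (ℕ.n<1+n m) 1+m<n)
      l = fromℕ< 1+m<n
      k≡m   = toℕ-fromℕ< (ℕ.<-trans (ℕ.n<1+n m) 1+m<n)
      l≡1+m = toℕ-fromℕ< 1+m<n

      column : ∀ i {p q} → p ≡ m → q ≡ suc m →
               H (suc (suc m)) i q ≈ s (suc m) * H (suc m) i q + x m * H (suc m) i p
      column i ≡.refl ≡.refl = begin
        H (suc (suc m)) i (suc m)              ≈⟨ H-below i ℕ.≤-refl ⟩
        V i (suc m)                            ≈⟨ V₊ i m ⟩
        s (suc m) * A i (suc m) + x m * V i m
          ≈⟨ +-cong (*-congˡ (H-above i ℕ.≤-refl)) (*-congˡ (H-below i ℕ.≤-refl)) ⟨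
        s (suc m) * H (suc m) i (suc m) + x m * H (suc m) i m ∎

    go : ∀ m → m ℕ.≤ n → det (section (H m) n) ≈ ∏ m s * det (section A n)
    go zero    _   = sym (*-identityˡ _)
    go (suc m) m<n = begin
      det (section (H (suc m)) n)        ≈⟨ step m m<n ⟩
      s m * det (section (H m) n)        ≈⟨ *-congˡ (go m (ℕ.<⇒≤ m<n)) ⟩
      s m * (∏ m s * det (section A n))  ≈⟨ *-assoc _ _ _ ⟨
      ∏ (suc m) s * det (section A n)    ∎

-- Binomial transforms, and Pascal triangles from Toeplitz matrices.

open import Defs
open import Data.Rational.Base using (_+_; _-_; _*_)
open import Relation.Binary.PropositionalEquality using (refl; sym; trans; cong; cong₂)
open DeterminantProperties +-*-commutativeRing
open Exp (CommutativeRing.semiring +-*-commutativeRing) using () renaming (_^_ to _^ⁿ_)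
open +-*-Solver using (solve; con; _:=_; _:+_; _:*_; _:-_)
open ≡-Reasoning

-- The i-th term of the binomial transform, ∑ₘ (i choose m) w m.
binom : (ℕ → ℚ) → ℕ → ℚ
binom w zero    = w 0
binom w (suc i) = binom w i + binom (w ∘ suc) i

binom-linear : ∀ {w u v} s x → (∀ m → w m ≡ s * u m + x * v m) →
               ∀ i → binom w i ≡ s * binom u i + x * binom v i
binom-linear s x eq zero = eq 0
binom-linear {w} {u} {v} s x eq (suc i) = begin
  binom w i + binom (w ∘ suc) i
    ≡⟨ cong₂ _+_ (binom-linear s x eq i) (binom-linear s x (eq ∘ suc) i) ⟩
  (s * binom u i + x * binom v i) + (s * binom (u ∘ suc) i + x * binom (v ∘ suc) i)
    ≡⟨ solve 6 (λ s x p q r t → (s :* p :+ x :* q) :+ (s :* r :+ x :* t) :=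
                 s :* (p :+ r) :+ x :* (q :+ t)) refl s x _ _ _ _ ⟩
  s * (binom u i + binom (u ∘ suc) i) + x * (binom v i + binom (v ∘ suc) i) ∎

binom-cong : ∀ {w u} → (∀ m → w m ≡ u m) → ∀ i → binom w i ≡ binom u i
binom-cong eq zero    = eq 0
binom-cong eq (suc i) = cong₂ _+_ (binom-cong eq i) (binom-cong (eq ∘ suc) i)

binom-+ : ∀ u v i → binom (λ m → u m + v m) i ≡ binom u i + binom v i
binom-+ u v zero    = refl
binom-+ u v (suc i) = trans (cong₂ _+_ (binom-+ u v i) (binom-+ (u ∘ suc) (v ∘ suc) i))
  (solve 4 (λ a b c d → (a :+ b) :+ (c :+ d) := (a :+ c) :+ (b :+ d)) refl
     (binom u i) (binom v i) (binom (u ∘ suc) i) (binom (v ∘ suc) i))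

binom-const : ∀ c i → binom (const c) i ≡ c * 2ℚ ^ⁿ i
binom-const c zero    = sym (ℚ.*-identityʳ c)
binom-const c (suc i) = trans (cong₂ _+_ (binom-const c i) (binom-const c i))
  (solve 2 (λ c p → c :* p :+ c :* p := c :* (con 2ℚ :* p)) refl c (2ℚ ^ⁿ i))

-- Serves for the first row and column of the triangle, which are transforms of sequences `w 0`,
-- `c`, `c`, and so on.
binom-constTail : ∀ {w c} → (∀ m → w (suc m) ≡ c) → ∀ i → binom w i ≡ c * 2ℚ ^ⁿ i + (w 0 - c)
binom-constTail {w} {c} eq zero =
  solve 2 (λ w c → w := c :* con 1ℚ :+ (w :- c)) refl (w 0) c
binom-constTail {w} {c} eq (suc i) = begin
  binom w i + binom (w ∘ suc) i
    ≡⟨ cong₂ _+_ (binom-constTail eq i) (trans (binom-cong eq i) (binom-const c i)) ⟩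
  (c * 2ℚ ^ⁿ i + (w 0 - c)) + c * 2ℚ ^ⁿ i
    ≡⟨ solve 3 (λ w c p → (c :* p :+ (w :- c)) :+ c :* p := c :* (con 2ℚ :* p) :+ (w :- c))
         refl (w 0) c (2ℚ ^ⁿ i) ⟩
  c * 2ℚ ^ⁿ suc i + (w 0 - c) ∎

binom-zero : ∀ {w i} → (∀ {m} → m ℕ.≤ i → w m ≡ 0ℚ) → binom w i ≡ 0ℚ
binom-zero {i = zero}  w≡0 = w≡0 ℕ.z≤n
binom-zero {i = suc i} w≡0 =
  cong₂ _+_ (binom-zero (w≡0 ∘ ℕ.m≤n⇒m≤1+n)) (binom-zero (w≡0 ∘ ℕ.s≤s))

-- The term `w i` enters `binom w i` with coefficient 1 and later terms do not enter, so
-- transforming the columns of a lower triangular matrix keeps its shape and diagonal.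
binom-leading : ∀ {w} i → (∀ {m} → m ℕ.< i → w m ≡ 0ℚ) → binom w i ≡ w i
binom-leading     zero    w≡0 = refl
binom-leading {w} (suc i) w≡0 =
  trans (cong₂ _+_ (binom-zero {w} (w≡0 ∘ ℕ.s≤s)) (binom-leading i (w≡0 ∘ ℕ.s≤s))) (ℚ.+-identityˡ _)

-- Constancy along diagonals turns the recursion of `binom` into `row (suc i) (suc t) = row i (suc
-- t) + row i t`. Transforming this along `t` yields the Pascal rule for `Q`.
pascal-toeplitz : (T : ℕ → ℕ → ℚ) → (∀ m t → T (suc m) (suc t) ≡ T m t) →
                  ∀ {α β} → (∀ i → α i ≡ binom (λ m → T m 0) i) → (∀ j → β j ≡ binom (T 0) j) →
                  ∀ i j → pascal α β i j ≡ binom (λ t → binom (λ m → T m t) i) j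
pascal-toeplitz T T-suc α≡ β≡ i       zero    = α≡ i
pascal-toeplitz T T-suc α≡ β≡ zero    (suc j) = β≡ (suc j)
pascal-toeplitz T T-suc {α} {β} α≡ β≡ (suc i) (suc j) = begin
  pascal α β (suc i) j + pascal α β i (suc j)
    ≡⟨ cong₂ _+_ (pascal-toeplitz T T-suc α≡ β≡ (suc i) j) (pascal-toeplitz T T-suc α≡ β≡ i (suc j)) ⟩
  Q (suc i) j + (Q i j + binom (λ t → row i (suc t)) j)
    ≡⟨ cong (λ x → Q (suc i) j + x)
         (trans (ℚ.+-comm (Q i j) _) (sym (binom-+ (λ t → row i (suc t)) (row i) j))) ⟩
  Q (suc i) j + binom (λ t → row i (suc t) + row i t) j
    ≡⟨ cong (λ x → Q (suc i) j + x) (binom-cong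
         (λ t → cong (λ x → row i (suc t) + x) (sym (binom-cong (λ m → T-suc m t) i))) j) ⟩
  Q (suc i) j + binom (λ t → row (suc i) (suc t)) j ∎
  where
  row : ℕ → ℕ → ℚ
  row i t = binom (λ m → T m t) i

  Q : ℕ → ℕ → ℚ
  Q i j = binom (row i) j

-- Undoing a binomial transform by column operations.

∏-one-* : ∀ n p → ∏ n (const 1ℚ) * p ≡ p
∏-one-* zero    p = ℚ.*-identityˡ p
∏-one-* (suc n) p = trans (cong (_* p) (ℚ.*-identityˡ (∏ n (const 1ℚ)))) (∏-one-* n p)

-- Interpolates between binom w and w by successive differences of neighbouring terms.
stage : ℕ → (ℕ → ℚ) → ℕ → ℚ
stage zero    w j       = binom w j
stage (suc k) w zero    = w 0
stage (suc k) w (suc j) = stage k (w ∘ suc) j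

stage-done : ∀ {k} w {j} → j ℕ.< k → stage k w j ≡ w j
stage-done w {zero}  (ℕ.s≤s _)   = refl
stage-done w {suc j} (ℕ.s≤s j<k) = stage-done (w ∘ suc) j<k

stage-zero : ∀ k w → stage k w 0 ≡ w 0
stage-zero zero    w = refl
stage-zero (suc k) w = refl

-- An indicator used as a coefficient: it switches the column operation off on the columns up to
-- `k`.
[_≤_] : ℕ → ℕ → ℚ
[ zero  ≤ j     ] = 1ℚ
[ suc k ≤ zero  ] = 0ℚ
[ suc k ≤ suc j ] = [ k ≤ j ]

-- Beyond position `k`, `stage k w` is the transform of `w` shifted by `k`, and the identity is the
-- recursion of `binom`; up to `k`, both stages agree with `w`.
stage-suc : ∀ k w j → stage k w (suc j) ≡ 1ℚ * stage (suc k) w (suc j) + [ k ≤ j ] * stage k w j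
stage-suc zero w j =
  solve 2 (λ p q → p :+ q := con 1ℚ :* q :+ con 1ℚ :* p) refl (binom w j) (binom (w ∘ suc) j)
stage-suc (suc k) w zero = trans (stage-zero k (w ∘ suc))
  (solve 2 (λ p q → p := con 1ℚ :* p :+ con 0ℚ :* q) refl (w 1) (w 0))
stage-suc (suc k) w (suc j) = stage-suc k (w ∘ suc) j

det-binom : ∀ (W : ℕ → ℕ → ℚ) n → det (section (λ i → binom (W i)) n) ≡ det (section W n)
det-binom W n = trans (go n) (det-cong {n} λ i j → stage-done (W (toℕ i)) (toℕ<n j))
  where
  go : ∀ k → det (section (λ i → binom (W i)) n) ≡ det (section (λ i → stage k (W i)) n)
  go zero    = refl
  go (suc k) = begin
    det (section (λ i → binom (W i)) n)
      ≡⟨ go k ⟩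
    det (section (λ i → stage k (W i)) n)
      -- The sweep runs backwards: it rebuilds `stage k` from `stage (suc k)` by adding neighbours,
      -- with all scalings 1.
      ≡⟨ det-sweep (λ i → stage (suc k) (W i)) (λ i → stage k (W i)) (const 1ℚ) [ k ≤_]
           (λ i → trans (stage-zero k (W i)) (sym (ℚ.*-identityˡ _)))
           (λ i → stage-suc k (W i)) n ⟩
    ∏ n (const 1ℚ) * det (section (λ i → stage (suc k) (W i)) n)
      ≡⟨ ∏-one-* n _ ⟩
    det (section (λ i → stage (suc k) (W i)) n) ∎

-- Toeplitz determinants by fraction-free elimination.

-- Entry in column k and row m: x above the diagonal, y on it, z below it.
toeplitz : (x y z : ℚ) → ℕ → ℕ → ℚ
toeplitz x y z zero    zero    = y
toeplitz x y z zero    (suc m) = z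
toeplitz x y z (suc k) zero    = x
toeplitz x y z (suc k) (suc m) = toeplitz x y z k m

toeplitz-above : ∀ {x y z k m} → m ℕ.< k → toeplitz x y z k m ≡ x
toeplitz-above {k = suc k} {zero}  _           = refl
toeplitz-above {k = suc k} {suc m} (ℕ.s≤s m<k) = toeplitz-above m<k

toeplitz-diagonal : ∀ {x y z} k → toeplitz x y z k k ≡ y
toeplitz-diagonal zero    = refl
toeplitz-diagonal (suc k) = toeplitz-diagonal k

-- Neighbouring columns of the Toeplitz matrix differ only in rows `k` and `suc k`. The first
-- equation clears row `k`, the second gives the new diagonal entry, and below it the eliminated
-- column just doubles. Moving along the diagonal reduces to `k = 0`.
toeplitz-eliminate : ∀ a d b g f {g′ f′} →
  0ℚ ≡ g * (a - d) + 2ℚ * g → g′ ≡ g * (d - b) + 2ℚ * f → f′ ≡ 2ℚ * f → ∀ k m →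
  toeplitz 0ℚ g′ f′ (suc k) m ≡
    g * (toeplitz a d b (suc k) m - toeplitz a d b k m) + 2ℚ * toeplitz 0ℚ g f k m
toeplitz-eliminate a d b g f e₁ e₂ e₃ zero    zero          = e₁
toeplitz-eliminate a d b g f e₁ e₂ e₃ zero    (suc zero)    = e₂
toeplitz-eliminate a d b g f e₁ e₂ e₃ zero    (suc (suc m)) = trans e₃
  (solve 3 (λ b g f → con 2ℚ :* f := g :* (b :- b) :+ con 2ℚ :* f) refl b g f)
toeplitz-eliminate a d b g f e₁ e₂ e₃ (suc k) zero          =
  solve 2 (λ a g → con 0ℚ := g :* (a :- a) :+ con 2ℚ :* con 0ℚ) refl a g
toeplitz-eliminate a d b g f e₁ e₂ e₃ (suc k) (suc m)       =
  toeplitz-eliminate a d b g f e₁ e₂ e₃ k m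

∏-telescope : ∀ G → G 0 ≡ 1ℚ → ∀ n → ∏ n (G ∘ suc) ≡ ∏ n G * G n
∏-telescope G G₀ zero    = sym (trans (ℚ.*-identityˡ _) G₀)
∏-telescope G G₀ (suc n) = trans (cong (G (suc n) *_) (∏-telescope G G₀ n))
  (solve 3 (λ p q r → p :* (q :* r) := (r :* q) :* p) refl (G (suc n)) (∏ n G) (G n))

∏-positive : ∀ G → (∀ k → Positive (G k)) → ∀ n → Positive (∏ n G)
∏-positive G G>0 zero    = _
∏-positive G G>0 (suc n) = ℚ.pos*pos⇒pos (G n) {{G>0 n}} (∏ n G) {{∏-positive G G>0 n}}

*-cancelˡ-pos : ∀ r .{{_ : Positive r}} {p q} → r * p ≡ r * q → p ≡ q
*-cancelˡ-pos r eq = ℚ.≤-antisym (ℚ.*-cancelˡ-≤-pos r (ℚ.≤-reflexive eq))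
                                 (ℚ.*-cancelˡ-≤-pos r (ℚ.≤-reflexive (sym eq)))

-- G n is the determinant of the n × n Toeplitz matrix with diagonal d, entries
-- d - 2 above it and d + 1 below it; both sequences in the corollary have this form.
module ToeplitzDeterminant
  (d : ℚ) (G : ℕ → ℚ) (G>0 : ∀ k → Positive (G k))
  (G₀ : G 0 ≡ 1ℚ) (G₁ : G 1 ≡ d) (G₊ : ∀ k → G (suc (suc k)) ≡ G (suc k) + 2ℚ * G k) where

  a b : ℚ
  a = d - 2ℚ
  b = d + 1ℚ

  f : ℕ → ℚ
  f k = b * 2ℚ ^ⁿ k

  -- The recurrence has characteristic roots 2 and -1, so this sum doubles at each step, as the
  -- entries below the diagonal must.
  G-sum : ∀ k → G (suc k) + G k ≡ f k
  G-sum zero    = trans (cong₂ _+_ G₁ G₀) (sym (ℚ.*-identityʳ b))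
  G-sum (suc k) = begin
    G (suc (suc k)) + G (suc k)
      ≡⟨ cong (λ x → x + G (suc k)) (G₊ k) ⟩
    G (suc k) + 2ℚ * G k + G (suc k)
      ≡⟨ solve 2 (λ p q → p :+ con 2ℚ :* q :+ p := con 2ℚ :* (p :+ q)) refl (G (suc k)) (G k) ⟩
    2ℚ * (G (suc k) + G k)
      ≡⟨ cong (2ℚ *_) (G-sum k) ⟩
    2ℚ * (b * 2ℚ ^ⁿ k)
      ≡⟨ solve 2 (λ b p → con 2ℚ :* (b :* p) := b :* (con 2ℚ :* p)) refl b (2ℚ ^ⁿ k) ⟩
    f (suc k) ∎

  T : ℕ → ℕ → ℚ
  T m j = toeplitz a d b j m

  -- F consists of the column differences of W, and V of its columns after fraction-free
  -- elimination: up to binom, column k of V vanishes above its diagonal entry G (suc k).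
  W F V : ℕ → ℕ → ℚ
  W i j = binom (λ m → T m j) i

  F i zero    = W i 0
  F i (suc j) = binom (λ m → T m (suc j) - T m j) i

  V i k = binom (toeplitz 0ℚ (G (suc k)) (f k) k) i

  W-suc : ∀ i j → W i (suc j) ≡ 1ℚ * F i (suc j) + 1ℚ * W i j
  W-suc i j = binom-linear 1ℚ 1ℚ
    (λ m → solve 2 (λ p q → p := con 1ℚ :* (p :- q) :+ con 1ℚ :* q) refl (T m (suc j)) (T m j)) i

  -- Column 0 has nothing above its diagonal entry to eliminate, and its multiplier `G 0` is 1.
  V-zero : ∀ i → V i 0 ≡ G 0 * F i 0
  V-zero i = trans (binom-cong eq i) (sym (trans (cong (_* W i 0) G₀) (ℚ.*-identityˡ _)))
    where
    eq : ∀ m → toeplitz 0ℚ (G 1) (f 0) 0 m ≡ toeplitz a d b 0 m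
    eq zero    = G₁
    eq (suc m) = ℚ.*-identityʳ b

  V-suc : ∀ i k → V i (suc k) ≡ G (suc k) * F i (suc k) + 2ℚ * V i k
  V-suc i k = binom-linear (G (suc k)) 2ℚ (toeplitz-eliminate a d b g (f k) above diagonal below k) i
    where
    g = G (suc k)

    above : 0ℚ ≡ g * (a - d) + 2ℚ * g
    above = solve 2 (λ g d → con 0ℚ := g :* ((d :- con 2ℚ) :- d) :+ con 2ℚ :* g) refl g d

    below : f (suc k) ≡ 2ℚ * f k
    below = solve 2 (λ b p → b :* (con 2ℚ :* p) := con 2ℚ :* (b :* p)) refl b (2ℚ ^ⁿ k)

    diagonal : G (suc (suc k)) ≡ g * (d - b) + 2ℚ * f k
    diagonal = begin
      G (suc (suc k))
        ≡⟨ G₊ k ⟩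
      g + 2ℚ * G k
        ≡⟨ solve 3 (λ g h d → g :+ con 2ℚ :* h := g :* (d :- (d :+ con 1ℚ)) :+ con 2ℚ :* (g :+ h))
             refl g (G k) d ⟩
      g * (d - b) + 2ℚ * (g + G k)
        ≡⟨ cong (λ h → g * (d - b) + 2ℚ * h) (G-sum k) ⟩
      g * (d - b) + 2ℚ * f k ∎

  -- `det (section V n)` is computed twice: the sweep from `F` contributes the factor `∏ n G`, while
  -- the triangular shape gives the product of `G 1` to `G n`. Positivity allows `∏ n G` to be
  -- cancelled.
  det-W : ∀ n → det (section W n) ≡ G n
  det-W n = *-cancelˡ-pos (∏ n G) {{∏-positive G G>0 n}} (begin
    ∏ n G * det (section W n)
      ≡⟨ cong (∏ n G *_) (det-sweep F W (const 1ℚ) (const 1ℚ) (λ i → sym (ℚ.*-identityˡ _)) W-suc n) ⟩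
    ∏ n G * (∏ n (const 1ℚ) * det (section F n))
      ≡⟨ cong (∏ n G *_) (∏-one-* n (det (section F n))) ⟩
    ∏ n G * det (section F n)
      ≡⟨ det-sweep F V G (const 2ℚ) V-zero V-suc n ⟨
    det (section V n)
      ≡⟨ det-lowerTriangular V (λ i<k → binom-zero λ m≤i → toeplitz-above (ℕ.≤-<-trans m≤i i<k)) n ⟩
    ∏ n (λ k → V k k)
      ≡⟨ ∏-cong (λ k → trans (binom-leading k toeplitz-above) (toeplitz-diagonal k)) n ⟩
    ∏ n (G ∘ suc)
      ≡⟨ ∏-telescope G G₀ n ⟩
    ∏ n G * G n ∎)

  -- The conditions on `α` and `β` describe the transforms of the first column `d`, `b`, `b`, ...
  -- and the first row `d`, `a`, `a`, ... of `T`; the constants are `d - b = -1` and `d - a = 2`.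
  det-P : ∀ {α β} → (∀ i → α i ≡ b * 2ℚ ^ⁿ i - 1ℚ) → (∀ j → β j ≡ a * 2ℚ ^ⁿ j + 2ℚ) →
          ∀ n → det (P α β n) ≡ G (suc n)
  det-P {α} {β} α≡ β≡ n = begin
    det (P α β n)
      ≡⟨ det-cong {suc n} (λ i j → pascal-toeplitz T (λ _ _ → refl) column row (toℕ i) (toℕ j)) ⟩
    det (section (λ i → binom (W i)) (suc n))
      ≡⟨ det-binom W (suc n) ⟩
    det (section W (suc n))
      ≡⟨ det-W (suc n) ⟩
    G (suc n) ∎
    where
    column : ∀ i → α i ≡ W i 0
    column i = trans (α≡ i) (sym (trans (binom-constTail (λ _ → refl) i)
      (cong (λ x → b * 2ℚ ^ⁿ i + x)
        (solve 1 (λ d → d :- (d :+ con 1ℚ) := con (ℚ.- 1ℚ)) refl d))))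

    row : ∀ j → β j ≡ binom (T 0) j
    row j = trans (β≡ j) (sym (trans (binom-constTail (λ _ → refl) j)
      (cong (λ x → a * 2ℚ ^ⁿ j + x)
        (solve 1 (λ d → d :- (d :- con 2ℚ) := con 2ℚ) refl d))))

-- Jacobsthal numbers as rationals, and the two cases.

jacobsthal-nonZero : ∀ n → ℕ.NonZero (jacobsthal (suc n))
jacobsthal-nonZero zero    = _
jacobsthal-nonZero (suc n) =
  ℕ.>-nonZero (ℕ.<-≤-trans (ℕ.>-nonZero⁻¹ _ {{jacobsthal-nonZero n}}) (ℕ.m≤m+n _ _))

fromℕ-positive : ∀ n .{{_ : ℕ.NonZero n}} → Positive (fromℕ n)
fromℕ-positive n = ℚ.normalize-pos n 1

toℚᵘ-fromℕ : ∀ n → ℚ.toℚᵘ (fromℕ n) ℚᵘ.≃ (+ n ℚᵘ./ 1)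
toℚᵘ-fromℕ n = ℚ.toℚᵘ-fromℚᵘ (+ n ℚᵘ./ 1)

-- Passes through unnormalised rationals, where adding fractions of denominator 1 involves no
-- reduction by a gcd.
fromℕ-+ : ∀ m n → fromℕ (m ℕ.+ n) ≡ fromℕ m + fromℕ n
fromℕ-+ m n = ℚ.toℚᵘ-injective (ℚᵘ.≃-trans (toℚᵘ-fromℕ (m ℕ.+ n)) (ℚᵘ.≃-sym
  (ℚᵘ.≃-trans (ℚ.toℚᵘ-homo-+ (fromℕ m) (fromℕ n))
  (ℚᵘ.≃-trans (ℚᵘ.+-cong (toℚᵘ-fromℕ m) (toℚᵘ-fromℕ n))
    (ℚᵘ.*≡* (cong (ℤ._* + 1) (cong₂ ℤ._+_ (ℤ.*-identityʳ (+ m)) (ℤ.*-identityʳ (+ n)))))))))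

jacobsthal-suc : ∀ n → fromℕ (jacobsthal (suc (suc n))) ≡
                 fromℕ (jacobsthal (suc n)) + 2ℚ * fromℕ (jacobsthal n)
jacobsthal-suc n =
  trans (fromℕ-+ j′ (2 ℕ.* j)) (cong (λ x → fromℕ j′ + x) (begin
    fromℕ (j ℕ.+ (j ℕ.+ 0))  ≡⟨ cong (λ k → fromℕ (j ℕ.+ k)) (ℕ.+-identityʳ j) ⟩
    fromℕ (j ℕ.+ j)          ≡⟨ fromℕ-+ j j ⟩
    fromℕ j + fromℕ j        ≡⟨ solve 1 (λ x → x :+ x := con 2ℚ :* x) refl (fromℕ j) ⟩
    2ℚ * fromℕ j             ∎))
  where
  j  = jacobsthal n
  j′ = jacobsthal (suc n)

corollary8 : (α β : ℕ → ℚ) → α 0 ≡ β 0 →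
    ( (∀ i → α i ≡ 2ℚ ^ (+ i ℤ.+ + 1) - 1ℚ) →
    (∀ i → β i ≡ 2ℚ * (1ℚ - 2ℚ ^ (+ i ℤ.- + 1))) →
    ∀ n → det (P α β n) ≡ fromℕ (jacobsthal (n ℕ.+ 2)) )
    ×
    ( (∀ i → α i ≡ 2ℚ ^ (+ i ℤ.+ + 2) - 1ℚ) →
    (∀ i → β i ≡ 2ℚ * (2ℚ ^ (+ i ℤ.- + 1) + 1ℚ)) →
    ∀ n → det (P α β n) ≡ fromℕ (jacobsthal (n ℕ.+ 3)) )
corollary8 α β _ = part₁ , part₂
  where
  -- At `i = 0` the exponent is -1 and the factor 2 cancels 1/2; after the case split both sides
  -- compute.
  2^ : ∀ i → 2ℚ * 2ℚ ^ (+ i ℤ.- + 1) ≡ 2ℚ ^ⁿ i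
  2^ zero    = refl
  2^ (suc i) = refl

  part₁ : (∀ i → α i ≡ 2ℚ ^ (+ i ℤ.+ + 1) - 1ℚ) →
          (∀ i → β i ≡ 2ℚ * (1ℚ - 2ℚ ^ (+ i ℤ.- + 1))) →
          ∀ n → det (P α β n) ≡ fromℕ (jacobsthal (n ℕ.+ 2))
  part₁ α≡ β≡ n = trans
    -- Here `d = 1`, `a = -1` and `b = 2`; the index shift by 1 makes `G 0 = 1` and `G 1 = d`.
    (ToeplitzDeterminant.det-P 1ℚ (λ k → fromℕ (jacobsthal (1 ℕ.+ k)))
       (λ k → fromℕ-positive _ {{jacobsthal-nonZero k}}) refl refl (λ k → jacobsthal-suc (1 ℕ.+ k))
       (λ i → trans (α≡ i) (cong (λ k → 2ℚ ^ⁿ k - 1ℚ) (ℕ.+-comm i 1)))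
       (λ j → trans (β≡ j) (trans
         (solve 1 (λ x → con 2ℚ :* (con 1ℚ :- x) := con (1ℚ - 2ℚ) :* (con 2ℚ :* x) :+ con 2ℚ)
            refl (2ℚ ^ (+ j ℤ.- + 1)))
         (cong (λ x → (1ℚ - 2ℚ) * x + 2ℚ) (2^ j))))
       n)
    (cong (λ k → fromℕ (jacobsthal k)) (ℕ.+-comm 2 n))

  part₂ : (∀ i → α i ≡ 2ℚ ^ (+ i ℤ.+ + 2) - 1ℚ) →
          (∀ i → β i ≡ 2ℚ * (2ℚ ^ (+ i ℤ.- + 1) + 1ℚ)) →
          ∀ n → det (P α β n) ≡ fromℕ (jacobsthal (n ℕ.+ 3))
  part₂ α≡ β≡ n = trans
    -- Here `d = 3`, `a = 1` and `b = 4`; `G` starts with the Jacobsthal numbers 1 and 3, of indices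
    -- 2 and 3.
    (ToeplitzDeterminant.det-P (fromℕ 3) (λ k → fromℕ (jacobsthal (2 ℕ.+ k)))
       (λ k → fromℕ-positive _ {{jacobsthal-nonZero (suc k)}}) refl refl (λ k → jacobsthal-suc (2 ℕ.+ k))
       (λ i → trans (α≡ i) (trans (cong (λ k → 2ℚ ^ⁿ k - 1ℚ) (ℕ.+-comm i 2))
         (solve 1 (λ x → con 2ℚ :* (con 2ℚ :* x) :- con 1ℚ := con (fromℕ 3 + 1ℚ) :* x :- con 1ℚ)
            refl (2ℚ ^ⁿ i))))
       (λ j → trans (β≡ j) (trans
         (solve 1 (λ x → con 2ℚ :* (x :+ con 1ℚ) := con (fromℕ 3 - 2ℚ) :* (con 2ℚ :* x) :+ con 2ℚ)
            refl (2ℚ ^ (+ j ℤ.- + 1)))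
         (cong (λ x → (fromℕ 3 - 2ℚ) * x + 2ℚ) (2^ j))))
       n)
    (cong (λ k → fromℕ (jacobsthal k)) (ℕ.+-comm 3 n))
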